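{- Let $[\widehat{0},\widehat{1}]$ be any Eulerian poset of rank $n+1$, and let $c_0,c_1,\ldots,c_{\lfloor n/2\rfloor}$ be integers. Then $$ \operatorname{t}([\widehat{0},\widehat{1}),x)=\sum_{k=0}^{\left\lfloor n/2\right\rfloor} c_k\, t_{n-2k}(x) $$ holds if and only if $$ g([\widehat{0},\widehat{1}),x)=\sum_{k=0}^{\left\lfloor n/2\right\rfloor} c_k\, x^k . $$
   Context: A graded poset is a finite poset with a unique minimum $\widehat{0}$, a unique maximum $\widehat{1}$ and a rank function $\rho:P\to\mathbb{N}$ with $\rho(\widehat{0})=0$ and $\rho(y)=\rho(x)+1$ whenever $y$ covers $x$; its rank is $\rho(\widehat{1})$. It is Eulerian if $\sum_{z\in[u,v]}(-1)^{\rho(z)}=0$ for all $u<v$. Write $[\widehat{0},p)=\{q: q<p\}$. Stanley's toric polynomials: $f(\emptyset,x)=g(\emptyset,x)=1$ ($\emptyset$ being $[\widehat{0},\widehat{1})$ for the Eulerian poset of rank $0$), and for an Eulerian poset of rank at least $1$, $$f([\widehat{0},\widehat{1}),x)=\sum_{p\in[\widehat{0},\widehat{1})} g([\widehat{0},p),x)(x-1)^{\rho(\widehat{1})-1-\rho(p)},$$ $$g([\widehat{0},\widehat{1}),x)=\sum_{i=0}^{\lfloor(\rho(\widehat{1})-1)/2\rfloor}\left([x^i]f([\widehat{0},\widehat{1}),x)-[x^{i-1}]f([\widehat{0},\widehat{1}),x)\right)x^i.$$ By a theorem of Stanley, if the rank is $n+1$ then $f([\widehat{0},\widehat{1}),x)$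 has degree $n$ and satisfies $x^nf([\widehat{0},\widehat{1}),1/x)=f([\widehat{0},\widehat{1}),x)$. Short toric polynomial: for an Eulerian poset of rank $n+1$, $\operatorname{t}([\widehat{0},\widehat{1}),x)$ is the unique polynomial $q(x)$ of degree $n$ with $q(x)=(-1)^nq(-x)$ and $f([\widehat{0},\widehat{1}),x)=x^{n/2}\left(q(\sqrt{x})+q(1/\sqrt{x})-q(0)\right)$; equivalently, it is obtained from $x^{n}f([\widehat{0},\widehat{1}),x^{ -2})$ by discarding all terms of negative degree. $t_m(x)$ denotes the short toric polynomial of the Boolean algebra of rank $m+1$ (with its maximum removed); explicitly $t_m(x)=\sum_{k=0}^{\lfloor m/2\rfloor}x^{m-2k}$ for $m\geq0$. -}

module Defs where

open import Level using (_⊔_) renaming (suc to lsuc)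
open import Data.Nat.Base as ℕ using (ℕ; zero; suc; _∸_; ⌊_/2⌋; z≤n; s≤s)
import Data.Nat.Properties as ℕP
open import Data.Integer.Base as ℤ using (ℤ; 0ℤ; 1ℤ; -1ℤ)
import Data.Integer.Properties as ℤP
open import Data.Fin.Base using (Fin; zero; suc; toℕ; fromℕ<)
import Data.Fin.Properties as FinP
open import Data.Fin.Induction using (spo-wellFounded)
open import Data.List.Base using (List; []; _∷_; map; foldr; filter; lookup; replicate; _++_)
open import Data.List.Properties using (map-cong; filter-accept; filter-reject)
open import Data.List.Relation.Unary.Any using (index)
open import Data.List.Relation.Unary.Any.Properties using (lookup-index)
import Data.List.Relation.Unary.Enumerates.Setoid as Enumerates
import Data.List.Relation.Unary.Unique.Setoid as Unique
import Data.Vec.Functional as Vector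
open import Data.Product.Base using (_×_; _,_; ∃)
open import Data.Sum.Base using (_⊎_; inj₁; inj₂)
open import Induction.WellFounded using (Acc; acc; WellFounded)
open import Relation.Binary.Bundles using (DecPoset)
open import Relation.Binary.Definitions using (Minimum; Maximum; Decidable)
open import Relation.Binary.Structures using (IsStrictPartialOrder)
import Relation.Binary.Construct.NonStrictToStrict as ToStrict
import Relation.Binary.Construct.On as On
import Relation.Binary.Properties.Poset as PosetProperties
open import Relation.Binary.PropositionalEquality using (_≡_; _≢_; refl; sym; trans; cong; cong₂; subst; module ≡-Reasoning)
open import Relation.Nullary using (¬_; Dec; yes; no; contradiction)
open import Relation.Nullary.Decidable using (_×-dec_)

------------------------------------------------------------------------
-- Polynomials over ℤ

-- Coefficient lists, constant term first.  Trailing zeros are allowed, so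
-- equality of polynomials is _≋_ rather than _≡_.
Poly : Set
Poly = List ℤ

coeff : Poly → ℕ → ℤ
coeff []      _       = 0ℤ
coeff (a ∷ p) zero    = a
coeff (a ∷ p) (suc k) = coeff p k

infix 4 _≋_
_≋_ : Poly → Poly → Set
p ≋ q = ∀ k → coeff p k ≡ coeff q k

infixl 6 _+ₚ_
infixl 7 _*ₚ_
infixr 7 _·ₚ_
infixr 8 _^ₚ_

_+ₚ_ : Poly → Poly → Poly
[]      +ₚ q       = q
(a ∷ p) +ₚ []      = a ∷ p
(a ∷ p) +ₚ (b ∷ q) = (a ℤ.+ b) ∷ (p +ₚ q)

_·ₚ_ : ℤ → Poly → Poly
a ·ₚ p = map (a ℤ.*_) p

_*ₚ_ : Poly → Poly → Poly
[]      *ₚ q = []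
(a ∷ p) *ₚ q = (a ·ₚ q) +ₚ (0ℤ ∷ (p *ₚ q))

_^ₚ_ : Poly → ℕ → Poly
p ^ₚ zero  = 1ℤ ∷ []
p ^ₚ suc k = p *ₚ (p ^ₚ k)

x^_ : ℕ → Poly
x^ k = replicate k 0ℤ ++ (1ℤ ∷ [])

x-1 : Poly
x-1 = -1ℤ ∷ 1ℤ ∷ []

∑ : ∀ m → (Fin (suc m) → Poly) → Poly
∑ m p = Vector.foldr _+ₚ_ [] p

infix 5 ∑
syntax ∑ m (λ k → p) = ∑[ k ≤ m ] p

------------------------------------------------------------------------
-- Graded and Eulerian posets

record GradedPoset c ℓ₁ ℓ₂ : Set (lsuc (c ⊔ ℓ₁ ⊔ ℓ₂)) where
  field
    decPoset : DecPoset c ℓ₁ ℓ₂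

  open DecPoset decPoset public
  open PosetProperties poset public
    using (_<_; <-isStrictPartialOrder; <-respˡ-≈; <-respʳ-≈)

  -- z covers y.
  _⋖_ : Carrier → Carrier → Set (c ⊔ ℓ₁ ⊔ ℓ₂)
  y ⋖ z = y < z × (∀ w → ¬ (y < w × w < z))

  -- Finiteness: elements lists every element exactly once, up to _≈_.
  field
    elements : List Carrier
    complete : Enumerates.IsEnumeration Eq.setoid elements
    distinct : Unique.Unique Eq.setoid elements
    0̂ 1̂      : Carrier
    0̂-min    : Minimum _≤_ 0̂
    1̂-max    : Maximum _≤_ 1̂
    ρ        : Carrier → ℕ
    ρ-cong   : ∀ {y z} → y ≈ z → ρ y ≡ ρ z
    ρ-0̂      : ρ 0̂ ≡ 0
    ρ-⋖      : ∀ {y z} → y ⋖ z → ρ z ≡ suc (ρ y)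

  rank : ℕ
  rank = ρ 1̂

  _<?_ : Decidable _<_
  _<?_ = ToStrict.<-decidable _≈_ _≤_ _≟_ _≤?_

  <-wellFounded : WellFounded _<_
  <-wellFounded y = go (index (complete y)) (lookup-index (complete y)) (⊏-wf _)
    where
    _⊏_ : Fin _ → Fin _ → Set _
    i ⊏ j = lookup elements i < lookup elements j

    ⊏-wf : WellFounded _⊏_
    ⊏-wf = spo-wellFounded (On.isStrictPartialOrder (lookup elements) <-isStrictPartialOrder)

    go : ∀ {z} i → z ≈ lookup elements i → Acc _⊏_ i → Acc _<_ z
    go i z≈i (acc rs) = acc λ {w} w<z →
      go (index (complete w)) (lookup-index (complete w))
        (rs (<-respʳ-≈ z≈i (<-respˡ-≈ (lookup-index (complete w)) w<z)))

module _ {c ℓ₁ ℓ₂} (P : GradedPoset c ℓ₁ ℓ₂) where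
  open GradedPoset P using (Carrier; _<_; _≤?_; elements; ρ)

  interval : Carrier → Carrier → List Carrier
  interval u v = filter (λ z → (u ≤? z) ×-dec (z ≤? v)) elements

  IsEulerian : Set (c ⊔ ℓ₁ ⊔ ℓ₂)
  IsEulerian = ∀ {u v} → u < v →
    foldr ℤ._+_ 0ℤ (map (λ z → -1ℤ ℤ.^ ρ z) (interval u v)) ≡ 0ℤ

------------------------------------------------------------------------
-- Toric polynomials

-- g of a poset of rank r in terms of its f.  The coefficient of xⁱ in
-- 0 ∷ f, which is x f, is [xⁱ⁻¹] f, to be read as 0 for i = 0.
gOf : ℕ → Poly → Poly
gOf zero    f = 1ℤ ∷ []
gOf (suc d) f = ∑[ i ≤ ⌊ d /2⌋ ]
  (coeff f (toℕ i) ℤ.- coeff (0ℤ ∷ f) (toℕ i)) ·ₚ x^ toℕ i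

-- The terms of non-negative degree of xⁿ f(x⁻²), namely [xⁱ]f · xⁿ⁻²ⁱ for
-- 2i ≤ n.
truncate : ℕ → Poly → Poly
truncate n f = ∑[ i ≤ ⌊ n /2⌋ ] coeff f (toℕ i) ·ₚ x^ (n ∸ 2 ℕ.* toℕ i)

module _ {c ℓ₁ ℓ₂} (P : GradedPoset c ℓ₁ ℓ₂) where
  open GradedPoset P using (Carrier; _<_; _<?_; <-wellFounded; elements; ρ; 1̂; rank)

  -- f p and g p are Stanley's polynomials of the half-open interval [0̂ , p),
  -- that is, of the graded poset [0̂ , p], whose rank is ρ p and whose rank
  -- function is the restriction of ρ.
  private
    term : ∀ p → (∀ q → q < p → Poly) → ℕ → Carrier → Poly
    term p rec d q with q <? p
    ... | yes q<p = gOf (ρ q) (rec q q<p) *ₚ x-1 ^ₚ (d ∸ ρ q)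
    ... | no  _   = []

    fAcc : ∀ p → Acc _<_ p → Poly
    fAcc p (acc rs) with ρ p
    ... | zero  = 1ℤ ∷ []
    ... | suc d = foldr _+ₚ_ [] (map (term p (λ q q<p → fAcc q (rs q<p)) d) elements)

  f g : Carrier → Poly
  f p = fAcc p (<-wellFounded p)
  g p = gOf (ρ p) (f p)

  -- The defining recursion of f.
  f-zero : ∀ p → ρ p ≡ 0 → f p ≡ 1ℤ ∷ []
  f-zero p = step (<-wellFounded p)
    where
    step : (h : Acc _<_ p) → ρ p ≡ 0 → fAcc p h ≡ 1ℤ ∷ []
    step (acc _) eq with ρ p | eq
    ... | zero | refl = refl

  private
    term-cong : ∀ p {r r′ : ∀ q → q < p → Poly} → (∀ q q<p → r q q<p ≡ r′ q q<p) →
                ∀ d q → term p r d q ≡ term p r′ d q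
    term-cong p h d q with q <? p
    ... | yes q<p = cong (λ u → gOf (ρ q) u *ₚ x-1 ^ₚ (d ∸ ρ q)) (h q q<p)
    ... | no  _   = refl

    fAcc-irrelevant : ∀ p (h h′ : Acc _<_ p) → fAcc p h ≡ fAcc p h′
    fAcc-irrelevant p (acc rs) (acc rs′) with ρ p
    ... | zero  = refl
    ... | suc d = cong (foldr _+ₚ_ []) (map-cong
      (term-cong p (λ q q<p → fAcc-irrelevant q (rs q<p) (rs′ q<p)) d) elements)

    sum-term : ∀ p d qs →
      foldr _+ₚ_ [] (map (term p (λ q _ → f q) d) qs) ≡
      foldr _+ₚ_ [] (map (λ q → g q *ₚ x-1 ^ₚ (d ∸ ρ q)) (filter (_<? p) qs))
    sum-term p d []       = refl
    sum-term p d (q ∷ qs) = case (q <? p)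
      where
      summand : Carrier → Poly
      summand r = g r *ₚ x-1 ^ₚ (d ∸ ρ r)

      term-yes : q < p → term p (λ r _ → f r) d q ≡ summand q
      term-yes q<p with q <? p
      ... | yes _   = refl
      ... | no  q≮p = contradiction q<p q≮p

      term-no : ¬ (q < p) → term p (λ r _ → f r) d q ≡ []
      term-no q≮p with q <? p
      ... | yes q<p = contradiction q<p q≮p
      ... | no  _   = refl

      case : Dec (q < p) →
        foldr _+ₚ_ [] (map (term p (λ r _ → f r) d) (q ∷ qs)) ≡
        foldr _+ₚ_ [] (map summand (filter (_<? p) (q ∷ qs)))
      case (yes q<p) = trans (cong₂ _+ₚ_ (term-yes q<p) (sum-term p d qs))
        (cong (λ rs → foldr _+ₚ_ [] (map summand rs)) (sym (filter-accept (_<? p) q<p)))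
      case (no q≮p) = trans (cong₂ _+ₚ_ (term-no q≮p) (sum-term p d qs))
        (cong (λ rs → foldr _+ₚ_ [] (map summand rs)) (sym (filter-reject (_<? p) q≮p)))

  f-suc : ∀ p {d} → ρ p ≡ suc d →
    f p ≡ foldr _+ₚ_ [] (map (λ q → g q *ₚ x-1 ^ₚ (d ∸ ρ q)) (filter (_<? p) elements))
  f-suc p eq = trans (step (<-wellFounded p) eq) (sum-term p _ elements)
    where
    step : ∀ {d} (h : Acc _<_ p) → ρ p ≡ suc d →
      fAcc p h ≡ foldr _+ₚ_ [] (map (term p (λ q _ → f q) d) elements)
    step (acc rs) eq with ρ p | eq
    ... | suc d | refl = cong (foldr _+ₚ_ []) (map-cong
      (term-cong p (λ q q<p → fAcc-irrelevant q (rs q<p) (<-wellFounded q)) d) elements)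

  toricF toricG : Poly
  toricF = f 1̂
  toricG = g 1̂

  -- Meaningful for rank n + 1 only; then rank ∸ 1 is n.
  shortToric : Poly
  shortToric = truncate (rank ∸ 1) toricF

-- Closed form xᵐ + xᵐ⁻² + xᵐ⁻⁴ + … of the short toric polynomial of the
-- Boolean algebra of rank m + 1.
t : ℕ → Poly
t m = ∑[ k ≤ ⌊ m /2⌋ ] x^ (m ∸ 2 ℕ.* toℕ k)

------------------------------------------------------------------------
-- The short toric polynomial is also described as the unique q of degree n
-- with q(x) = (-1)ⁿ q(-x) and f(x) = x^(n/2) (q(√x) + q(1/√x) - q(0)).
-- Any such q is shortToric (shortToric-unique, at the end).

-- q(-x)
reflect : Poly → Poly
reflect []      = []
reflect (a ∷ q) = a ∷ -1ℤ ·ₚ reflect q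

-- p(x²)
square : Poly → Poly
square []      = []
square (a ∷ p) = a ∷ 0ℤ ∷ square p

-- xⁿ q(1/x), for q of degree at most n.
reciprocal : ℕ → Poly → Poly
reciprocal n q = ∑[ i ≤ n ] coeff q (toℕ i) ·ₚ x^ (n ∸ toℕ i)

record IsShortToric (n : ℕ) (f q : Poly) : Set where
  field
    leading    : coeff q n ≢ 0ℤ
    degree     : ∀ k → n ℕ.< k → coeff q k ≡ 0ℤ
    parity     : q ≋ (-1ℤ ℤ.^ n) ·ₚ reflect q
    -- The equation for f, with x² substituted for x.
    symmetrize : square f ≋
      x^ n *ₚ q +ₚ reciprocal n q +ₚ (ℤ.- coeff q 0) ·ₚ x^ n

coeff-+ : ∀ p q k → coeff (p +ₚ q) k ≡ coeff p k ℤ.+ coeff q k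
coeff-+ []      q       k       = sym (ℤP.+-identityˡ _)
coeff-+ (a ∷ p) []      k       = sym (ℤP.+-identityʳ _)
coeff-+ (a ∷ p) (b ∷ q) zero    = refl
coeff-+ (a ∷ p) (b ∷ q) (suc k) = coeff-+ p q k

coeff-· : ∀ a p k → coeff (a ·ₚ p) k ≡ a ℤ.* coeff p k
coeff-· a []      k       = sym (ℤP.*-zeroʳ a)
coeff-· a (b ∷ p) zero    = refl
coeff-· a (b ∷ p) (suc k) = coeff-· a p k

coeff-x^-≡ : ∀ m → coeff (x^ m) m ≡ 1ℤ
coeff-x^-≡ zero    = refl
coeff-x^-≡ (suc m) = coeff-x^-≡ m

coeff-x^-≢ : ∀ m k → m ≢ k → coeff (x^ m) k ≡ 0ℤ
coeff-x^-≢ zero    zero    m≢k = contradiction refl m≢k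
coeff-x^-≢ zero    (suc k) m≢k = refl
coeff-x^-≢ (suc m) zero    m≢k = refl
coeff-x^-≢ (suc m) (suc k) m≢k = coeff-x^-≢ m k (λ e → m≢k (cong suc e))

coeff-·x^-≡ : ∀ a m → coeff (a ·ₚ x^ m) m ≡ a
coeff-·x^-≡ a m = trans (coeff-· a (x^ m) m) (trans (cong (a ℤ.*_) (coeff-x^-≡ m)) (ℤP.*-identityʳ a))

coeff-·x^-≢ : ∀ a m k → m ≢ k → coeff (a ·ₚ x^ m) k ≡ 0ℤ
coeff-·x^-≢ a m k m≢k = trans (coeff-· a (x^ m) k) (trans (cong (a ℤ.*_) (coeff-x^-≢ m k m≢k)) (ℤP.*-zeroʳ a))

coeff-Σ-0 : ∀ m (p : Fin m → Poly) k → (∀ i → coeff (p i) k ≡ 0ℤ) → coeff (Vector.foldr _+ₚ_ [] p) k ≡ 0ℤ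
coeff-Σ-0 zero p k h = refl
coeff-Σ-0 (suc m) p k h = trans (coeff-+ (p zero) _ k)
  (cong₂ ℤ._+_ (h zero) (coeff-Σ-0 m (λ i → p (suc i)) k (λ i → h (suc i))))

coeff-Σ-1 : ∀ m (p : Fin m → Poly) k j → (∀ i → i ≢ j → coeff (p i) k ≡ 0ℤ) →
  coeff (Vector.foldr _+ₚ_ [] p) k ≡ coeff (p j) k
coeff-Σ-1 (suc m) p k zero h = trans (coeff-+ (p zero) _ k) (trans (cong (λ z → coeff (p zero) k ℤ.+ z)
   (coeff-Σ-0 m (λ i → p (suc i)) k (λ i → h (suc i) λ ()))) (ℤP.+-identityʳ _))
coeff-Σ-1 (suc m) p k (suc j) h = trans (coeff-+ (p zero) _ k)
  (trans (cong₂ ℤ._+_ (h zero λ ()) (coeff-Σ-1 m (λ i → p (suc i)) k j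
     (λ i i≢j → h (suc i) (λ e → i≢j (FinP.suc-injective e))))) (ℤP.+-identityˡ _))

coeff-shift : ∀ m q k → coeff (x^ m *ₚ q) (m ℕ.+ k) ≡ coeff q k
coeff-shift zero    q k = trans (coeff-+ (1ℤ ·ₚ q) (0ℤ ∷ []) k)
  (trans (cong₂ ℤ._+_ (trans (coeff-· 1ℤ q k) (ℤP.*-identityˡ _)) (z k)) (ℤP.+-identityʳ _))
  where z : ∀ k → coeff (0ℤ ∷ []) k ≡ 0ℤ
        z zero = refl
        z (suc k) = refl
coeff-shift (suc m) q k = trans (coeff-+ (0ℤ ·ₚ q) _ (suc m ℕ.+ k))
  (trans (cong₂ ℤ._+_ (coeff-· 0ℤ q (suc m ℕ.+ k)) (coeff-shift m q k)) (ℤP.+-identityˡ _))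

coeff-below : ∀ m q k → k ℕ.< m → coeff (x^ m *ₚ q) k ≡ 0ℤ
coeff-below (suc m) q zero k<m = trans (coeff-+ (0ℤ ·ₚ q) _ 0) (cong₂ ℤ._+_ (coeff-· 0ℤ q 0) refl)
coeff-below (suc m) q (suc k) (s≤s k<m) = trans (coeff-+ (0ℤ ·ₚ q) _ (suc k))
  (cong₂ ℤ._+_ (coeff-· 0ℤ q (suc k)) (coeff-below m q k k<m))

coeff-square : ∀ p i → coeff (square p) (2 ℕ.* i) ≡ coeff p i
coeff-square []      i       = refl
coeff-square (a ∷ p) zero    = refl
coeff-square (a ∷ p) (suc i) rewrite ℕP.+-suc i (i ℕ.+ 0) = coeff-square p i

coeff-reflect : ∀ p k → coeff (reflect p) k ≡ (-1ℤ ℤ.^ k) ℤ.* coeff p k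
coeff-reflect []      k       = sym (ℤP.*-zeroʳ (-1ℤ ℤ.^ k))
coeff-reflect (a ∷ p) zero    = sym (ℤP.*-identityˡ a)
coeff-reflect (a ∷ p) (suc k) = trans (coeff-· -1ℤ (reflect p) k)
  (trans (cong (-1ℤ ℤ.*_) (coeff-reflect p k)) (sym (ℤP.*-assoc -1ℤ (-1ℤ ℤ.^ k) (coeff p k))))

even-odd : ∀ d → (∃ λ i → d ≡ 2 ℕ.* i) ⊎ (∃ λ i → d ≡ suc (2 ℕ.* i))
even-odd zero = inj₁ (0 , refl)
even-odd (suc d) with even-odd d
... | inj₁ (i , e) = inj₂ (i , cong suc e)
... | inj₂ (i , e) = inj₁ (suc i , trans (cong suc e) (cong suc (sym (ℕP.+-suc i (i ℕ.+ 0)))))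

-1^even : ∀ i → -1ℤ ℤ.^ (2 ℕ.* i) ≡ 1ℤ
-1^even i = trans (sym (ℤP.^-*-assoc -1ℤ 2 i)) (ℤP.^-zeroˡ i)

double-≤ : ∀ n i → 2 ℕ.* i ℕ.≤ n → i ℕ.≤ ⌊ n /2⌋
double-≤ n i h = subst (ℕ._≤ ⌊ n /2⌋) (sym (ℕP.n≡⌊n+n/2⌋ i))
  (ℕP.⌊n/2⌋-mono (subst (λ z → i ℕ.+ z ℕ.≤ n) (ℕP.+-identityʳ i) h))

≤-double : ∀ n (i : Fin (suc ⌊ n /2⌋)) → 2 ℕ.* toℕ i ℕ.≤ n
≤-double n i = begin
  2 ℕ.* toℕ i           ≤⟨ ℕP.*-monoʳ-≤ 2 (ℕ.s≤s⁻¹ (FinP.toℕ<n i)) ⟩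
  ⌊ n /2⌋ ℕ.+ (⌊ n /2⌋ ℕ.+ 0) ≡⟨ cong (⌊ n /2⌋ ℕ.+_) (ℕP.+-identityʳ _) ⟩
  ⌊ n /2⌋ ℕ.+ ⌊ n /2⌋   ≤⟨ ℕP.+-monoʳ-≤ _ (ℕP.⌊n/2⌋≤⌈n/2⌉ n) ⟩
  ⌊ n /2⌋ ℕ.+ ℕ.⌈ n /2⌉ ≡⟨ ℕP.⌊n/2⌋+⌈n/2⌉≡n n ⟩
  n ∎ where open ℕP.≤-Reasoning

private
  terms : ∀ n → Poly → Fin (suc ⌊ n /2⌋) → Poly
  terms n f i = coeff f (toℕ i) ·ₚ x^ (n ∸ 2 ℕ.* toℕ i)

truncate-unique : ∀ {n f q} → IsShortToric n f q → q ≋ truncate n f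
truncate-unique {n} {f} {q} S k with n ℕP.<? k
... | yes n<k = trans (degree k n<k) (sym (coeff-Σ-0 _ (terms n f) k λ i →
        coeff-·x^-≢ (coeff f (toℕ i)) (n ∸ 2 ℕ.* toℕ i) k (ℕP.<⇒≢ (ℕP.≤-<-trans (ℕP.m∸n≤m n (2 ℕ.* toℕ i)) n<k))))
  where open IsShortToric S
... | no n≮k with k≤n ← ℕP.≮⇒≥ n≮k | even-odd (n ∸ k)
... | inj₂ (i , e) = trans qk≡0 (sym (coeff-Σ-0 _ (terms n f) k λ j →
        coeff-·x^-≢ (coeff f (toℕ j)) (n ∸ 2 ℕ.* toℕ j) k (λ e′ → ℕP.even≢odd (toℕ j) i (trans (sym (n∸ j e′)) e))))
  where
  open IsShortToric S
  n∸ : ∀ j → n ∸ 2 ℕ.* toℕ j ≡ k → n ∸ k ≡ 2 ℕ.* toℕ j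
  n∸ j e′ = trans (cong (n ∸_) (sym e′)) (ℕP.m∸[m∸n]≡n (≤-double n j))
  n≡ : n ≡ suc (2 ℕ.* i) ℕ.+ k
  n≡ = trans (sym (ℕP.m∸n+n≡m k≤n)) (cong (ℕ._+ k) e)
  sgn : (-1ℤ ℤ.^ n) ℤ.* (-1ℤ ℤ.^ k) ≡ -1ℤ
  sgn = begin
    (-1ℤ ℤ.^ n) ℤ.* (-1ℤ ℤ.^ k) ≡⟨ ℤP.^-distribˡ-+-* -1ℤ n k ⟨
    -1ℤ ℤ.^ (n ℕ.+ k) ≡⟨ cong (λ z → -1ℤ ℤ.^ (z ℕ.+ k)) n≡ ⟩
    -1ℤ ℤ.* -1ℤ ℤ.^ (2 ℕ.* i ℕ.+ k ℕ.+ k) ≡⟨ cong (λ z → -1ℤ ℤ.* -1ℤ ℤ.^ z) (trans (ℕP.+-assoc (2 ℕ.* i) k k) (trans (cong (λ z → 2 ℕ.* i ℕ.+ (k ℕ.+ z)) (sym (ℕP.+-identityʳ k))) (sym (ℕP.*-distribˡ-+ 2 i k)))) ⟩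
    -1ℤ ℤ.* -1ℤ ℤ.^ (2 ℕ.* (i ℕ.+ k)) ≡⟨ cong (-1ℤ ℤ.*_) (-1^even (i ℕ.+ k)) ⟩
    -1ℤ ∎ where open ≡-Reasoning
  self : coeff q k ≡ ℤ.- coeff q k
  self = begin
    coeff q k ≡⟨ parity k ⟩
    coeff ((-1ℤ ℤ.^ n) ·ₚ reflect q) k ≡⟨ coeff-· (-1ℤ ℤ.^ n) (reflect q) k ⟩
    (-1ℤ ℤ.^ n) ℤ.* coeff (reflect q) k ≡⟨ cong ((-1ℤ ℤ.^ n) ℤ.*_) (coeff-reflect q k) ⟩
    (-1ℤ ℤ.^ n) ℤ.* ((-1ℤ ℤ.^ k) ℤ.* coeff q k) ≡⟨ ℤP.*-assoc (-1ℤ ℤ.^ n) (-1ℤ ℤ.^ k) (coeff q k) ⟨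
    (-1ℤ ℤ.^ n) ℤ.* (-1ℤ ℤ.^ k) ℤ.* coeff q k ≡⟨ cong (ℤ._* coeff q k) sgn ⟩
    -1ℤ ℤ.* coeff q k ≡⟨ ℤP.-1*i≡-i (coeff q k) ⟩
    ℤ.- coeff q k ∎ where open ≡-Reasoning
  neg : ∀ z → z ≡ ℤ.- z → z ≡ 0ℤ
  neg (ℤ.+ zero) _ = refl
  qk≡0 : coeff q k ≡ 0ℤ
  qk≡0 = neg _ self
... | inj₁ (i , e) = sym (begin
    coeff (truncate n f) k       ≡⟨ coeff-Σ-1 _ (terms n f) k j other ⟩
    coeff (coeff f (toℕ j) ·ₚ x^ (n ∸ 2 ℕ.* toℕ j)) k ≡⟨ cong (coeff (terms n f j)) (sym kj) ⟩
    coeff (coeff f (toℕ j) ·ₚ x^ (n ∸ 2 ℕ.* toℕ j)) (n ∸ 2 ℕ.* toℕ j) ≡⟨ coeff-·x^-≡ (coeff f (toℕ j)) (n ∸ 2 ℕ.* toℕ j) ⟩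
    coeff f (toℕ j) ≡⟨ cong (coeff f) j≡i ⟩
    coeff f i ≡⟨ coeff-square f i ⟨
    coeff (square f) (2 ℕ.* i) ≡⟨ symmetrize (2 ℕ.* i) ⟩
    coeff (x^ n *ₚ q +ₚ reciprocal n q +ₚ (ℤ.- coeff q 0) ·ₚ x^ n) (2 ℕ.* i) ≡⟨ coeff-+ (x^ n *ₚ q +ₚ reciprocal n q) ((ℤ.- coeff q 0) ·ₚ x^ n) (2 ℕ.* i) ⟩
    coeff (x^ n *ₚ q +ₚ reciprocal n q) (2 ℕ.* i) ℤ.+ coeff ((ℤ.- coeff q 0) ·ₚ x^ n) (2 ℕ.* i)
      ≡⟨ cong (λ z → z ℤ.+ coeff ((ℤ.- coeff q 0) ·ₚ x^ n) (2 ℕ.* i)) (coeff-+ (x^ n *ₚ q) (reciprocal n q) (2 ℕ.* i)) ⟩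
    coeff (x^ n *ₚ q) (2 ℕ.* i) ℤ.+ coeff (reciprocal n q) (2 ℕ.* i) ℤ.+ coeff ((ℤ.- coeff q 0) ·ₚ x^ n) (2 ℕ.* i)
      ≡⟨ cong (λ z → coeff (x^ n *ₚ q) (2 ℕ.* i) ℤ.+ z ℤ.+ coeff ((ℤ.- coeff q 0) ·ₚ x^ n) (2 ℕ.* i)) recip ⟩
    coeff (x^ n *ₚ q) (2 ℕ.* i) ℤ.+ coeff q k ℤ.+ coeff ((ℤ.- coeff q 0) ·ₚ x^ n) (2 ℕ.* i)
      ≡⟨ cancel k refl ⟩
    coeff q k ∎)
  where
  open IsShortToric S
  open ≡-Reasoning
  2i≤n : 2 ℕ.* i ℕ.≤ n
  2i≤n = subst (ℕ._≤ n) e (ℕP.m∸n≤m n k)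
  n∸2i : n ∸ 2 ℕ.* i ≡ k
  n∸2i = trans (cong (n ∸_) (sym e)) (ℕP.m∸[m∸n]≡n k≤n)
  j : Fin (suc ⌊ n /2⌋)
  j = fromℕ< (s≤s (double-≤ n i 2i≤n))
  j≡i : toℕ j ≡ i
  j≡i = FinP.toℕ-fromℕ< _
  kj : n ∸ 2 ℕ.* toℕ j ≡ k
  kj = trans (cong (λ z → n ∸ 2 ℕ.* z) j≡i) n∸2i
  other : ∀ l → l ≢ j → coeff (coeff f (toℕ l) ·ₚ x^ (n ∸ 2 ℕ.* toℕ l)) k ≡ 0ℤ
  other l l≢j = coeff-·x^-≢ (coeff f (toℕ l)) (n ∸ 2 ℕ.* toℕ l) k λ e′ → l≢j (FinP.toℕ-injective
    (ℕP.*-cancelˡ-≡ (toℕ l) (toℕ j) 2 (ℕP.∸-cancelˡ-≡ (≤-double n l) (≤-double n j) (trans e′ (sym kj)))))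
  m : Fin (suc n)
  m = fromℕ< (s≤s k≤n)
  m≡k : toℕ m ≡ k
  m≡k = FinP.toℕ-fromℕ< _
  nm : n ∸ toℕ m ≡ 2 ℕ.* i
  nm = trans (cong (n ∸_) m≡k) e
  rt : Fin (suc n) → Poly
  rt l = coeff q (toℕ l) ·ₚ x^ (n ∸ toℕ l)
  recip : coeff (reciprocal n q) (2 ℕ.* i) ≡ coeff q k
  recip = trans (coeff-Σ-1 _ rt (2 ℕ.* i) m (λ l l≢m → coeff-·x^-≢ (coeff q (toℕ l)) (n ∸ toℕ l) (2 ℕ.* i) λ e′ → l≢m (FinP.toℕ-injective
     (ℕP.∸-cancelˡ-≡ (ℕ.s≤s⁻¹ (FinP.toℕ<n l)) (ℕ.s≤s⁻¹ (FinP.toℕ<n m)) (trans e′ (sym nm))))))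
     (trans (cong (coeff (rt m)) (sym nm)) (trans (coeff-·x^-≡ (coeff q (toℕ m)) (n ∸ toℕ m)) (cong (coeff q) m≡k)))
  cancel : ∀ k′ → k′ ≡ k → coeff (x^ n *ₚ q) (2 ℕ.* i) ℤ.+ coeff q k ℤ.+ coeff ((ℤ.- coeff q 0) ·ₚ x^ n) (2 ℕ.* i) ≡ coeff q k
  cancel zero refl = begin
    _ ≡⟨ cong (λ z → coeff (x^ n *ₚ q) z ℤ.+ coeff q 0 ℤ.+ coeff ((ℤ.- coeff q 0) ·ₚ x^ n) z) (sym e) ⟩
    coeff (x^ n *ₚ q) n ℤ.+ coeff q 0 ℤ.+ coeff ((ℤ.- coeff q 0) ·ₚ x^ n) n
      ≡⟨ cong₂ (λ y z → y ℤ.+ coeff q 0 ℤ.+ z) (trans (cong (coeff (x^ n *ₚ q)) (sym (ℕP.+-identityʳ n))) (coeff-shift n q 0)) (coeff-·x^-≡ (ℤ.- coeff q 0) n) ⟩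
    coeff q 0 ℤ.+ coeff q 0 ℤ.- coeff q 0 ≡⟨ ℤP.+-assoc (coeff q 0) (coeff q 0) _ ⟩
    coeff q 0 ℤ.+ (coeff q 0 ℤ.- coeff q 0) ≡⟨ cong (λ z → coeff q 0 ℤ.+ z) (ℤP.+-inverseʳ (coeff q 0)) ⟩
    coeff q 0 ℤ.+ 0ℤ ≡⟨ ℤP.+-identityʳ _ ⟩
    coeff q 0 ∎
  cancel (suc k′) refl = begin
    _ ≡⟨ cong₂ (λ y z → y ℤ.+ coeff q k ℤ.+ z) (coeff-below n q (2 ℕ.* i) lt) (coeff-·x^-≢ (ℤ.- coeff q 0) n (2 ℕ.* i) (λ e′ → ℕP.<⇒≢ lt (sym e′))) ⟩
    0ℤ ℤ.+ coeff q k ℤ.+ 0ℤ ≡⟨ ℤP.+-identityʳ _ ⟩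
    0ℤ ℤ.+ coeff q k ≡⟨ ℤP.+-identityˡ _ ⟩
    coeff q k ∎
    where lt : 2 ℕ.* i ℕ.< n
          lt = subst (ℕ._< n) e (ℕP.∸-monoʳ-< {n} {suc k′} {0} (s≤s z≤n) k≤n)

shortToric-unique : ∀ {c ℓ₁ ℓ₂} (P : GradedPoset c ℓ₁ ℓ₂) {n q} →
  GradedPoset.rank P ≡ suc n → IsShortToric n (toricF P) q → q ≋ shortToric P
shortToric-unique P {n} {q} eq S =
  subst (λ r → q ≋ truncate (r ∸ 1) (toricF P)) (sym eq) (truncate-unique S)

{-# OPTIONS --safe #-}

-- Write fᵢ for the coefficients of f and n + 1 for the rank.  The short toric
-- polynomial has coefficient fᵢ at x^(n-2i), whereas ∑ cₖ t_(n-2k) has there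
-- the partial sum c₀ + … + cᵢ.  So the first equation says that f₀, f₁, … are
-- the partial sums of c, that is, that c consists of the differences
-- fᵢ - fᵢ₋₁, which are the coefficients of g.

module Submission where

open import Defs
open import Level using (Level)
open import Data.Nat.Base as ℕ using (ℕ; zero; suc; _∸_; _*_; ⌊_/2⌋)
import Data.Nat.Properties as ℕP
open import Data.Integer.Base as ℤ using (ℤ; 0ℤ)
import Data.Integer.Properties as ℤP
open import Data.Integer.Tactic.RingSolver using (solve-∀)
open import Data.Fin.Base using (Fin; zero; suc; toℕ)
open import Data.Fin.Properties using (toℕ-injective)
open import Data.List.Base using ([]; _∷_)
open import Algebra.Properties.AbelianGroup ℤP.+-0-abelianGroup using (∙-cancelˡ)
open import Algebra.Properties.CommutativeMonoid.Sum ℤP.+-0-commutativeMonoid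
  using (sum; sum-cong-≗; ∑-distrib-+)
open import Algebra.Properties.Semiring.Sum ℤP.+-*-semiring using (*-distribˡ-sum)
open import Function.Base using (_∘_)
open import Function.Bundles using (_⇔_; mk⇔; module Equivalence)
open import Function.Definitions using (Injective)
open import Function.Properties.Equivalence using () renaming (trans to ⇔-trans)
open import Relation.Binary.PropositionalEquality
  using (_≡_; _≗_; refl; sym; trans; cong; cong₂; subst; module ≡-Reasoning)

open ≡-Reasoning

coeff-∑ : ∀ m (p : Fin (suc m) → Poly) k →
  coeff (∑ m p) k ≡ sum (λ i → coeff (p i) k)
coeff-∑ zero    p k = coeff-+ (p zero) [] k
coeff-∑ (suc m) p k = trans (coeff-+ (p zero) (∑ m (p ∘ suc)) k)
  (cong (λ z → coeff (p zero) k ℤ.+ z) (coeff-∑ m (p ∘ suc) k))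

∑-cong : ∀ m (p q : Fin (suc m) → Poly) → (∀ i → p i ≋ q i) → ∑ m p ≋ ∑ m q
∑-cong m p q p≋q k = trans (coeff-∑ m p k)
  (trans (sum-cong-≗ (λ i → p≋q i k)) (sym (coeff-∑ m q k)))

module _ {m} {e : Fin (suc m) → ℕ} (e-injective : Injective _≡_ _≡_ e) where

  -- Since `e` is injective, no other summand reaches the exponent `e j`.
  coeff-∑-monomials : ∀ (a : Fin (suc m) → ℤ) j →
    coeff (∑[ i ≤ m ] a i ·ₚ x^ e i) (e j) ≡ a j
  coeff-∑-monomials a j = trans
    (coeff-Σ-1 (suc m) (λ i → a i ·ₚ x^ e i) (e j) j
      (λ i i≢j → coeff-·x^-≢ (a i) (e i) (e j) (i≢j ∘ e-injective)))
    (coeff-·x^-≡ (a j) (e j))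

  -- Used twice: with exponents n-2i for the short toric polynomial, and with exponents i for g.
  ∑-monomials-≋ : ∀ (a b : Fin (suc m) → ℤ) →
    (∑[ i ≤ m ] a i ·ₚ x^ e i) ≋ (∑[ i ≤ m ] b i ·ₚ x^ e i) ⇔ a ≗ b
  ∑-monomials-≋ a b = mk⇔
    (λ eq j → trans (sym (coeff-∑-monomials a j)) (trans (eq (e j)) (coeff-∑-monomials b j)))
    (λ eq → ∑-cong m (λ i → a i ·ₚ x^ e i) (λ i → b i ·ₚ x^ e i)
      (λ i k → cong (λ z → coeff (z ·ₚ x^ e i) k) (eq i)))

-- Recursion at the head adds the first entry to every later partial sum, just as the leading
-- summand in `∑-t` adds its coefficient at every exponent.
partialSum : ∀ {m} → (Fin m → ℤ) → Fin m → ℤ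
partialSum a zero    = a zero
partialSum a (suc i) = a zero ℤ.+ partialSum (a ∘ suc) i

partialSum-cong : ∀ {m} {a b : Fin m → ℤ} → a ≗ b → partialSum a ≗ partialSum b
partialSum-cong eq zero    = eq zero
partialSum-cong eq (suc i) = cong₂ ℤ._+_ (eq zero) (partialSum-cong (eq ∘ suc) i)

-- Position zero gives equal first entries; cancelling them from the later positions leaves equal
-- partial sums of the tails.
partialSum-injective : ∀ {m} (a b : Fin m → ℤ) → partialSum a ≗ partialSum b → a ≗ b
partialSum-injective a b eq zero    = eq zero
partialSum-injective a b eq (suc i) = partialSum-injective (a ∘ suc) (b ∘ suc) tails i
  where
  tails : partialSum (a ∘ suc) ≗ partialSum (b ∘ suc)
  tails j = ∙-cancelˡ (a zero) _ _
    (trans (eq (suc j)) (cong (ℤ._+ partialSum (b ∘ suc) j) (sym (eq zero))))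

-- General in `h` so that the induction can pass to `h ∘ suc`, which need not vanish at 0; hence the
-- term `h 0`.
telescope : ∀ (h : ℕ → ℤ) {m} (i : Fin m) →
  partialSum {m} (λ j → h (suc (toℕ j)) ℤ.- h (toℕ j)) i ≡ h (suc (toℕ i)) ℤ.- h 0
telescope h zero    = refl
telescope h (suc i) = trans
  (cong (λ z → h 1 ℤ.- h 0 ℤ.+ z) (telescope (h ∘ suc) i))
  (rearrange (h 1) (h 0) (h (suc (suc (toℕ i)))))
  where
  rearrange : ∀ x y z → (x ℤ.- y) ℤ.+ (z ℤ.- x) ≡ z ℤ.- y
  rearrange = solve-∀

-- Taking partial sums is injective and undoes taking differences.
differences-≗ : ∀ f {m} (c : Fin m → ℤ) →
  coeff f ∘ toℕ ≗ partialSum c ⇔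
  (λ i → coeff f (toℕ i) ℤ.- coeff (0ℤ ∷ f) (toℕ i)) ≗ c
differences-≗ f {m} c = mk⇔
  (λ eq → partialSum-injective difference c (λ i → trans (sums i) (eq i)))
  (λ eq i → trans (sym (sums i)) (partialSum-cong eq i))
  where
  difference : Fin m → ℤ
  difference i = coeff f (toℕ i) ℤ.- coeff (0ℤ ∷ f) (toℕ i)

  sums : partialSum difference ≗ coeff f ∘ toℕ
  -- The sequence `coeff (0ℤ ∷ f)` is 0 at 0 and `coeff f i` at `suc i`, so only `coeff f` survives
  -- the telescoping.
  sums i = trans (telescope (coeff (0ℤ ∷ f)) i) (ℤP.+-identityʳ _)

2+n∸2*1+k : ∀ n k → suc (suc n) ∸ 2 * suc k ≡ n ∸ 2 * k
2+n∸2*1+k n k = cong (suc (suc n) ∸_) (ℕP.*-suc 2 k)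

-- On this range 2i ≤ n, so the truncated subtraction is a true one and cancels.
n∸2*-injective : ∀ n → Injective _≡_ _≡_ (λ (i : Fin (suc ⌊ n /2⌋)) → n ∸ 2 * toℕ i)
n∸2*-injective n {i} {j} eq = toℕ-injective
  (ℕP.*-cancelˡ-≡ (toℕ i) (toℕ j) 2 (ℕP.∸-cancelˡ-≡ (≤-double n i) (≤-double n j) eq))

-- Induction in steps of two. The summand with `t (2 ℕ.+ n)` contributes `a zero` at x^(n+2) and at
-- every x^(n-2i); the other summands form the same sum for `n` with coefficients `a ∘ suc`.
∑-t : ∀ n (a : Fin (suc ⌊ n /2⌋) → ℤ) →
  (∑[ k ≤ ⌊ n /2⌋ ] a k ·ₚ t (n ∸ 2 * toℕ k)) ≋
  (∑[ i ≤ ⌊ n /2⌋ ] partialSum a i ·ₚ x^ (n ∸ 2 * toℕ i))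
∑-t zero          a k = refl
∑-t (suc zero)    a k = refl
∑-t (suc (suc n)) a k = begin
  coeff (a₀ ·ₚ t (2 ℕ.+ n) +ₚ ∑ M (λ i → a (suc i) ·ₚ t (2 ℕ.+ n ∸ 2 * suc (toℕ i)))) k
    ≡⟨ coeff-+ (a₀ ·ₚ t (2 ℕ.+ n)) _ k ⟩
  coeff (a₀ ·ₚ t (2 ℕ.+ n)) k ℤ.+ coeff (∑ M (λ i → a (suc i) ·ₚ t (2 ℕ.+ n ∸ 2 * suc (toℕ i)))) k
    ≡⟨ cong₂ ℤ._+_ head tail ⟩
  (a₀ ℤ.* top ℤ.+ sum (λ i → a₀ ℤ.* lower i)) ℤ.+ sum (λ i → s i ℤ.* lower i)
    ≡⟨ ℤP.+-assoc (a₀ ℤ.* top) _ _ ⟩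
  a₀ ℤ.* top ℤ.+ (sum (λ i → a₀ ℤ.* lower i) ℤ.+ sum (λ i → s i ℤ.* lower i))
    ≡⟨ cong (λ z → a₀ ℤ.* top ℤ.+ z) (∑-distrib-+ (λ i → a₀ ℤ.* lower i) (λ i → s i ℤ.* lower i)) ⟨
  a₀ ℤ.* top ℤ.+ sum (λ i → a₀ ℤ.* lower i ℤ.+ s i ℤ.* lower i)
    ≡⟨ cong (λ z → a₀ ℤ.* top ℤ.+ z) (sum-cong-≗ collect) ⟩
  a₀ ℤ.* top ℤ.+ sum (λ i → coeff (partialSum a (suc i) ·ₚ x^ (2 ℕ.+ n ∸ 2 * suc (toℕ i))) k)
    ≡⟨ cong (ℤ._+ sum (λ i → coeff (partialSum a (suc i) ·ₚ x^ (2 ℕ.+ n ∸ 2 * suc (toℕ i))) k))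
         (coeff-· a₀ (x^ (2 ℕ.+ n)) k) ⟨
  -- The term at index zero is `a₀ ·ₚ x^ (2 ℕ.+ n)` by computation, so the sum splits
  -- definitionally.
  sum {suc (suc M)} (λ i → coeff (partialSum a i ·ₚ x^ (2 ℕ.+ n ∸ 2 * toℕ i)) k)
    ≡⟨ coeff-∑ (suc M) (λ i → partialSum a i ·ₚ x^ (2 ℕ.+ n ∸ 2 * toℕ i)) k ⟨
  coeff (∑[ i ≤ suc M ] partialSum a i ·ₚ x^ (2 ℕ.+ n ∸ 2 * toℕ i)) k ∎
  where
  M : ℕ
  M = ⌊ n /2⌋

  a₀ top : ℤ
  a₀  = a zero
  top = coeff (x^ (2 ℕ.+ n)) k

  lower s : Fin (suc M) → ℤ
  lower i = coeff (x^ (n ∸ 2 * toℕ i)) k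
  s       = partialSum (a ∘ suc)

  head : coeff (a₀ ·ₚ t (2 ℕ.+ n)) k ≡ a₀ ℤ.* top ℤ.+ sum (λ i → a₀ ℤ.* lower i)
  head = begin
    coeff (a₀ ·ₚ t (2 ℕ.+ n)) k
      ≡⟨ coeff-· a₀ (t (2 ℕ.+ n)) k ⟩
    a₀ ℤ.* coeff (t (2 ℕ.+ n)) k
      ≡⟨ cong (a₀ ℤ.*_) (coeff-∑ (suc M) (λ i → x^ (2 ℕ.+ n ∸ 2 * toℕ i)) k) ⟩
    a₀ ℤ.* (top ℤ.+ sum {suc M} (λ i → coeff (x^ (2 ℕ.+ n ∸ 2 * suc (toℕ i))) k))
      ≡⟨ cong (λ z → a₀ ℤ.* (top ℤ.+ z))
           (sum-cong-≗ {suc M} (λ i → cong (λ d → coeff (x^ d) k) (2+n∸2*1+k n (toℕ i)))) ⟩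
    a₀ ℤ.* (top ℤ.+ sum lower)
      ≡⟨ ℤP.*-distribˡ-+ a₀ top (sum lower) ⟩
    a₀ ℤ.* top ℤ.+ a₀ ℤ.* sum lower
      ≡⟨ cong (λ z → a₀ ℤ.* top ℤ.+ z) (*-distribˡ-sum a₀ lower) ⟩
    a₀ ℤ.* top ℤ.+ sum (λ i → a₀ ℤ.* lower i) ∎

  tail : coeff (∑ M (λ i → a (suc i) ·ₚ t (2 ℕ.+ n ∸ 2 * suc (toℕ i)))) k ≡
         sum (λ i → s i ℤ.* lower i)
  tail = begin
    coeff (∑ M (λ i → a (suc i) ·ₚ t (2 ℕ.+ n ∸ 2 * suc (toℕ i)))) k
      ≡⟨ ∑-cong M (λ i → a (suc i) ·ₚ t (2 ℕ.+ n ∸ 2 * suc (toℕ i)))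
           (λ i → a (suc i) ·ₚ t (n ∸ 2 * toℕ i))
           (λ i l → cong (λ d → coeff (a (suc i) ·ₚ t d) l) (2+n∸2*1+k n (toℕ i))) k ⟩
    coeff (∑ M (λ i → a (suc i) ·ₚ t (n ∸ 2 * toℕ i))) k
      ≡⟨ ∑-t n (a ∘ suc) k ⟩
    coeff (∑ M (λ i → s i ·ₚ x^ (n ∸ 2 * toℕ i))) k
      ≡⟨ coeff-∑ M (λ i → s i ·ₚ x^ (n ∸ 2 * toℕ i)) k ⟩
    sum (λ i → coeff (s i ·ₚ x^ (n ∸ 2 * toℕ i)) k)
      ≡⟨ sum-cong-≗ (λ i → coeff-· (s i) (x^ (n ∸ 2 * toℕ i)) k) ⟩
    sum (λ i → s i ℤ.* lower i) ∎

  collect : ∀ i → a₀ ℤ.* lower i ℤ.+ s i ℤ.* lower i ≡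
                  coeff (partialSum a (suc i) ·ₚ x^ (2 ℕ.+ n ∸ 2 * suc (toℕ i))) k
  collect i = begin
    a₀ ℤ.* lower i ℤ.+ s i ℤ.* lower i
      ≡⟨ ℤP.*-distribʳ-+ (lower i) a₀ (s i) ⟨
    (a₀ ℤ.+ s i) ℤ.* lower i
      ≡⟨ coeff-· (a₀ ℤ.+ s i) (x^ (n ∸ 2 * toℕ i)) k ⟨
    coeff ((a₀ ℤ.+ s i) ·ₚ x^ (n ∸ 2 * toℕ i)) k
      ≡⟨ cong (λ d → coeff ((a₀ ℤ.+ s i) ·ₚ x^ d) k) (2+n∸2*1+k n (toℕ i)) ⟨
    coeff ((a₀ ℤ.+ s i) ·ₚ x^ (2 ℕ.+ n ∸ 2 * suc (toℕ i))) k ∎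

-- After `∑-t` both sides are combinations of the same monomials x^(n-2i), and coefficients can be
-- compared.
truncate-≋-∑-t : ∀ n f (c : Fin (suc ⌊ n /2⌋) → ℤ) →
  truncate n f ≋ (∑[ k ≤ ⌊ n /2⌋ ] c k ·ₚ t (n ∸ 2 * toℕ k)) ⇔ coeff f ∘ toℕ ≗ partialSum c
truncate-≋-∑-t n f c = ⇔-trans
  (mk⇔ (λ eq k → trans (eq k) (∑-t n c k)) (λ eq k → trans (eq k) (sym (∑-t n c k))))
  (∑-monomials-≋ (n∸2*-injective n) (coeff f ∘ toℕ) (partialSum c))

truncate-⇔-gOf : ∀ n f (c : Fin (suc ⌊ n /2⌋) → ℤ) →
  (truncate n f ≋ ∑[ k ≤ ⌊ n /2⌋ ] c k ·ₚ t (n ∸ 2 * toℕ k))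
    ⇔ (gOf (suc n) f ≋ ∑[ k ≤ ⌊ n /2⌋ ] c k ·ₚ x^ toℕ k)
truncate-⇔-gOf n f c = ⇔-trans (truncate-≋-∑-t n f c) (⇔-trans (differences-≗ f c)
  -- `gOf (suc n) f` unfolds to the monomial sum with the differences as coefficients; `monomials`
  -- leads from polynomials to coefficients and is reversed here.
  (mk⇔ (from monomials) (to monomials)))
  where
  open Equivalence
  monomials = ∑-monomials-≋ toℕ-injective
    (λ i → coeff f (toℕ i) ℤ.- coeff (0ℤ ∷ f) (toℕ i)) c

proposition5p4 : {a ℓ₁ ℓ₂ : Level} (P : GradedPoset a ℓ₁ ℓ₂) → IsEulerian P →
    (n : ℕ) → GradedPoset.rank P ≡ suc n →
    (c : Fin (suc ⌊ n /2⌋) → ℤ) →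
    (shortToric P ≋ ∑[ k ≤ ⌊ n /2⌋ ] c k ·ₚ t (n ∸ 2 * toℕ k))
      ⇔ (toricG P ≋ ∑[ k ≤ ⌊ n /2⌋ ] c k ·ₚ x^ (toℕ k))
-- Only the rank in `r ∸ 1` and `gOf r` is abstracted, while `toricF P` stays fixed; at `suc n` the
-- first reduces to `n`.
proposition5p4 P _ n rank≡1+n c = subst
  (λ r → (truncate (r ∸ 1) (toricF P) ≋ ∑[ k ≤ ⌊ n /2⌋ ] c k ·ₚ t (n ∸ 2 * toℕ k))
    ⇔ (gOf r (toricF P) ≋ ∑[ k ≤ ⌊ n /2⌋ ] c k ·ₚ x^ (toℕ k)))
  (sym rank≡1+n) (truncate-⇔-gOf n (toricF P) c)
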